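{- Let $X$ be a normal modal logic and let $I$ be an index set with $\omega\subseteq I$. Suppose that $X$ is complete with respect to a set of Kripke frames $F=\{(G_\alpha,R_\alpha):\alpha\in I\}$, where for every $\alpha\in I$, $G_\alpha$ is a nonempty infinite set and $R_\alpha$ is an accessibility relation (a binary relation) on $G_\alpha$. Let $H=\{(G_i^*,R_i^*): i\in\omega\}$ be a set of Kripke frames such that for every $i\in\omega$: $$G_i^*=\{*,g_0,g_1,\dots,g_i\}\cup G_{\omega i},$$ where $G_{\omega i}=\{\eta_{ij}: j\in\omega\}$ has cardinality $\aleph_0$, $\{*,g_0,\dots,g_i\}\cap G_{\omega i}=\emptyset$, the elements $*,g_0,\dots,g_i$ are distinct, and $$R_i^*=\{(*,g_j):0\le j\le i\}\cup\{(g_j,*):0\le j\le i\}\cup\{(g_j,g_k): j\ne k,\ 1\le j\le i,\ 1\le k\le i\}\cup\{(\eta,\eta):\eta\in G_{\omega i}\}.$$ If $H\subseteq F$, then $B$-translation is faithful with respect to $X$.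
   Context: The system $\mathbf{L_1}$ (Leśniewski's propositional ontology): fix a countably infinite set of name variables. The atomic formulas are exactly the expressions $\epsilon ab$ with $a,b$ name variables (possibly equal); formulas are built from atomic formulas by $\vee$ and $\neg$, the other connectives being the usual classical abbreviations. $\mathbf{L_1}$ is a Hilbert-style system of classical propositional logic (with modus ponens) over these formulas with the additional axiom schemata, for all name variables $a,b,c$: (Ax1) $\epsilon ab \supset \epsilon aa$; (Ax2) $(\epsilon ab \wedge \epsilon bc) \supset \epsilon ac$; (Ax3) $(\epsilon ab \wedge \epsilon bc) \supset \epsilon ba$. $B$-translation: to each name variable $a$ corresponds a propositional variable $p_a$, with distinct name variables corresponding to distinct propositional variables. $B$ maps formulas of $\mathbf{L_1}$ to propositional modal formulas by $B(\phi\vee\psi)=B(\phi)\vee B(\psi)$, $B(\neg\phi)=\neg B(\phi)$, $B(\epsilon ab)=p_a\wedge\Box(p_a\supset p_b)\wedge\bigl(p_b\supset\Box(p_b\supset p_a)\bigr)$. $B$-translation is faithful with respect to a modal logic $X$ if for every formula $\phi$ of $\mathbf{L_1}$, $\vdash_X B(\phi)$ implies $\vdash_{\mathbf{L_1}}\phi$. A normal modal logic is a set $X$ of propositional modal formulas with $\mathbf{K}\subseteq X$ that is closed under modus ponens, substitution and necessitation. $X$ is complete with respect to a set $F$ of Kripke frames if, for every modal formula $\chi$, $\vdash_X\chi$ holds if and only if $\chi$ is valid in every frame in $F$. -}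

module Defs where

open import Data.Fin using (Fin; toℕ)
open import Data.Nat using (ℕ; suc; _≤_)
open import Data.Product using (_×_; ∃-syntax)
open import Data.Sum using (_⊎_)
open import Function.Bundles using (_↣_; _⇔_; _⤖_; Injection)
open import Function.Definitions using (Injective)
open import Level using (Level; _⊔_) renaming (suc to lsuc)
open import Relation.Binary.Core using (Rel)
open import Relation.Binary.PropositionalEquality using (_≡_; _≢_)
open import Relation.Nullary using (¬_)
open import Relation.Unary using (Pred; _⊆_)

private
  variable
    a x i ℓ : Level

NameVar : Set
NameVar = ℕ

PropVar : Set
PropVar = ℕ

-- Formulas of L₁ and modal formulas both have ∨ and ∼ as primitive Boolean
-- connectives; abbreviations and classical axiom schemata are shared.
module Classical {Fm : Set} (_∨_ : Fm → Fm → Fm) (∼_ : Fm → Fm) where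

  infixr 6 _∧_
  infixr 4 _⊃_

  _⊃_ : Fm → Fm → Fm
  φ ⊃ ψ = (∼ φ) ∨ ψ

  _∧_ : Fm → Fm → Fm
  φ ∧ ψ = ∼ ((∼ φ) ∨ (∼ ψ))

  -- Together with modus ponens: the Łukasiewicz axioms for ⊃ and ∼, and the
  -- usual axioms for the primitive ∨.
  data Axiom : Fm → Set where
    K-ax   : ∀ φ ψ   → Axiom (φ ⊃ (ψ ⊃ φ))
    S-ax   : ∀ φ ψ χ → Axiom ((φ ⊃ (ψ ⊃ χ)) ⊃ ((φ ⊃ ψ) ⊃ (φ ⊃ χ)))
    contra : ∀ φ ψ   → Axiom (((∼ φ) ⊃ (∼ ψ)) ⊃ (ψ ⊃ φ))
    ∨-inˡ  : ∀ φ ψ   → Axiom (φ ⊃ (φ ∨ ψ))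
    ∨-inʳ  : ∀ φ ψ   → Axiom (ψ ⊃ (φ ∨ ψ))
    ∨-elim : ∀ φ ψ χ → Axiom ((φ ⊃ χ) ⊃ ((ψ ⊃ χ) ⊃ ((φ ∨ ψ) ⊃ χ)))

module L₁ where

  infix  8 ∼_
  infixr 5 _∨_

  data Formula : Set where
    ε   : NameVar → NameVar → Formula
    _∨_ : Formula → Formula → Formula
    ∼_  : Formula → Formula

  open Classical _∨_ ∼_ public

  infix 2 ⊢_

  data ⊢_ : Formula → Set where
    prop : ∀ {φ} → Axiom φ → ⊢ φ
    ax1  : ∀ a b → ⊢ ε a b ⊃ ε a a
    ax2  : ∀ a b c → ⊢ (ε a b ∧ ε b c) ⊃ ε a c
    ax3  : ∀ a b c → ⊢ (ε a b ∧ ε b c) ⊃ ε b a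
    mp   : ∀ {φ ψ} → ⊢ φ ⊃ ψ → ⊢ φ → ⊢ ψ

module Modal where

  infix  8 ∼_ □_
  infixr 5 _∨_

  data Formula : Set where
    var : PropVar → Formula
    _∨_ : Formula → Formula → Formula
    ∼_  : Formula → Formula
    □_  : Formula → Formula

  open Classical _∨_ ∼_ public

  _[_] : Formula → (PropVar → Formula) → Formula
  var p   [ σ ] = σ p
  (φ ∨ ψ) [ σ ] = (φ [ σ ]) ∨ (ψ [ σ ])
  (∼ φ)   [ σ ] = ∼ (φ [ σ ])
  (□ φ)   [ σ ] = □ (φ [ σ ])

  data K : Formula → Set where
    prop : ∀ {φ} → Axiom φ → K φ
    dist : ∀ φ ψ → K (□ (φ ⊃ ψ) ⊃ (□ φ ⊃ □ ψ))
    mp   : ∀ {φ ψ} → K (φ ⊃ ψ) → K φ → K ψ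
    nec  : ∀ {φ} → K φ → K (□ φ)

  record IsNormal (X : Pred Formula x) : Set x where
    field
      K⊆X        : K ⊆ X
      mp-closed  : ∀ {φ ψ} → X (φ ⊃ ψ) → X φ → X ψ
      sub-closed : ∀ {φ} (σ : PropVar → Formula) → X φ → X (φ [ σ ])
      nec-closed : ∀ {φ} → X φ → X (□ φ)

record Frame ℓ : Set (lsuc ℓ) where
  field
    World : Set ℓ
    _R_   : Rel World ℓ

module _ (𝓕 : Frame ℓ) where
  open Frame 𝓕
  open Modal

  -- Truth is two-valued in Kripke semantics. Double negations at variables and
  -- at ∨ make every truth value ¬¬-stable, so that the classical laws hold at
  -- every world without assuming excluded middle; under excluded middle they
  -- can be dropped.
  Forces : (PropVar → Pred World ℓ) → World → Formula → Set ℓ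
  Forces V w (var p) = ¬ ¬ V p w
  Forces V w (φ ∨ ψ) = ¬ ¬ (Forces V w φ ⊎ Forces V w ψ)
  Forces V w (∼ φ)   = ¬ Forces V w φ
  Forces V w (□ φ)   = ∀ u → w R u → Forces V u φ

  Valid : Formula → Set (lsuc ℓ)
  Valid φ = ∀ V w → Forces V w φ

CompleteWrt : Pred Modal.Formula x → {I : Set i} → (I → Frame ℓ) → Set (x ⊔ i ⊔ lsuc ℓ)
CompleteWrt X F = ∀ χ → X χ ⇔ (∀ α → Valid (F α) χ)

Infinite : Set a → Set a
Infinite A = ∀ n → ¬ (A ⤖ Fin n)

module _ {W : Set ℓ} (n : ℕ) (⋆ : W) (g : Fin (suc n) → W) (η : ℕ → W) where

  data StarRel : W → W → Set ℓ where
    ⋆→g : ∀ j → StarRel ⋆ (g j)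
    g→⋆ : ∀ j → StarRel (g j) ⋆
    g→g : ∀ j k → j ≢ k → 1 ≤ toℕ j → 1 ≤ toℕ k → StarRel (g j) (g k)
    η→η : ∀ j → StarRel (η j) (η j)

-- The objects ⋆, g₀, …, gₙ, η₀, η₁, … are arbitrary, so this is a property of a
-- frame rather than one particular type of worlds.
record IsStarFrame (n : ℕ) (𝓕 : Frame ℓ) : Set ℓ where
  open Frame 𝓕
  field
    ⋆ : World
    g : Fin (suc n) → World
    η : ℕ → World

    g-injective : Injective _≡_ _≡_ g
    η-injective : Injective _≡_ _≡_ η
    ⋆≢g         : ∀ j → ⋆ ≢ g j
    ⋆≢η         : ∀ k → ⋆ ≢ η k
    g≢η         : ∀ j k → g j ≢ η k

    exhaustive  : ∀ w → w ≡ ⋆ ⊎ (∃[ j ] w ≡ g j) ⊎ (∃[ k ] w ≡ η k)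
    R⇔StarRel   : ∀ u v → u R v ⇔ StarRel n ⋆ g η u v

module _ (p : NameVar ↣ PropVar) where
  open Modal

  private
    p[_] : NameVar → Formula
    p[ a ] = var (Injection.to p a)

  B : L₁.Formula → Formula
  B (L₁.ε a b)   = p[ a ] ∧ □ (p[ a ] ⊃ p[ b ]) ∧ (p[ b ] ⊃ □ (p[ b ] ⊃ p[ a ]))
  B (φ L₁.∨ ψ)   = B φ ∨ B ψ
  B (L₁.∼ φ)     = ∼ B φ

  Faithful : Pred Formula x → Set x
  Faithful X = ∀ φ → X (B φ) → L₁.⊢ φ

{-# OPTIONS --safe #-}

-- Contrapositively, a formula unprovable in L₁ is false in some Boolean-valued
-- relation v that satisfies the L₁ axioms on the finitely many names 0, …, n
-- (Kalmár's completeness argument, with the axiom instances as hypotheses).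
-- On the n-th star frame such a v is its own Kripke valuation: let p_a hold at
-- g_j iff v j a, and at ⋆ iff v a a.  Since the successors of ⋆ are exactly
-- the g_j, the formula B(ε a b) holds at ⋆ iff v a b: testing □(p_a ⊃ p_b) at
-- g_a yields v a b from v a a, and conversely the inclusions between p_a and
-- p_b are instances of (Ax2) and (Ax3).
module Submission where

open import Defs
open import Data.Bool using (Bool; true; false; not; T; if_then_else_)
  renaming (_∨_ to _∨ᵇ_)
open import Data.Bool.Properties using (T?; T-∨)
open import Data.Empty using (⊥-elim)
open import Data.Fin using (Fin; toℕ; fromℕ<)
open import Data.Fin.Properties using (toℕ-fromℕ<; toℕ≤pred[n])
open import Data.List using (List; []; _∷_; upTo; cartesianProduct; concatMap; map)
open import Data.List.Membership.Propositional using (_∈_)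
open import Data.List.Membership.Propositional.Properties
  using (∈-cartesianProduct⁺; ∈-upTo⁺)
open import Data.List.Relation.Unary.All as All using (All; []; _∷_)
open import Data.List.Relation.Unary.All.Properties using (concat⁻; map⁻)
open import Data.List.Relation.Unary.Any using (here; there)
open import Data.Nat using (ℕ; suc; _≤_; s≤s; _⊔_; _≟_)
open import Data.Nat.Properties using (≤-refl; m⊔n≤o⇒m≤o; m⊔n≤o⇒n≤o)
open import Data.Product using (_×_; _,_; ∃-syntax; proj₁; proj₂)
open import Data.Product.Properties using (≡-dec)
open import Data.Sum using (_⊎_; inj₁; inj₂)
open import Data.Unit using (tt)
open import Function.Base using (_∘_)
open import Function.Bundles using (_↣_; Injection; Equivalence)
open import Level using (Level)
open import Relation.Binary.PropositionalEquality using (_≡_; refl; sym; subst)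
open import Relation.Nullary using (¬_; Dec; yes; no; does; contradiction)
open import Relation.Nullary.Decidable using (decidable-stable)
open import Relation.Unary using (Pred)

open L₁

private
  variable
    φ ψ χ : Formula
    Γ : List Formula

-- Derivability from hypotheses

infix 2 _⊩_

-- Theorems of L₁ enter as leaves and modus ponens is the only rule, so the deduction theorem holds
-- for every derivation.
data _⊩_ (Γ : List Formula) : Formula → Set where
  hyp : φ ∈ Γ → Γ ⊩ φ
  thm : ⊢ φ → Γ ⊩ φ
  app : Γ ⊩ φ ⊃ ψ → Γ ⊩ φ → Γ ⊩ ψ

⊩-closed : [] ⊩ φ → ⊢ φ
⊩-closed (thm d)   = d
⊩-closed (app d e) = mp (⊩-closed d) (⊩-closed e)

weaken : Γ ⊩ φ → ψ ∷ Γ ⊩ φ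
weaken (hyp i)   = hyp (there i)
weaken (thm d)   = thm d
weaken (app d e) = app (weaken d) (weaken e)

axiom : Axiom φ → Γ ⊩ φ
axiom = thm ∘ prop

⊃-const : Γ ⊩ φ → Γ ⊩ ψ ⊃ φ
⊃-const d = app (axiom (K-ax _ _)) d

⊃-refl : ∀ φ → Γ ⊩ φ ⊃ φ
⊃-refl φ = app (app (axiom (S-ax φ (φ ⊃ φ) φ)) (axiom (K-ax _ _))) (axiom (K-ax φ φ))

deduction : φ ∷ Γ ⊩ ψ → Γ ⊩ φ ⊃ ψ
deduction (hyp (here refl)) = ⊃-refl _
deduction (hyp (there i))   = ⊃-const (hyp i)
deduction (thm d)           = ⊃-const (thm d)
deduction (app d e)         = app (app (axiom (S-ax _ _ _)) (deduction d)) (deduction e)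

explosion : Γ ⊩ ∼ φ → Γ ⊩ φ → Γ ⊩ ψ
explosion d e = app (app (axiom (contra _ _)) (⊃-const d)) e

⊩-∨-elim : Γ ⊩ φ ∨ ψ → φ ∷ Γ ⊩ χ → ψ ∷ Γ ⊩ χ → Γ ⊩ χ
⊩-∨-elim d e f = app (app (app (axiom (∨-elim _ _ _)) (deduction e)) (deduction f)) d

-- φ ⊃ φ unfolds to ∼ φ ∨ φ, which is excluded middle.
by-cases : ∀ φ → φ ∷ Γ ⊩ ψ → ∼ φ ∷ Γ ⊩ ψ → Γ ⊩ ψ
by-cases φ d e = ⊩-∨-elim (⊃-refl φ) e d

⊩-∼∼ : Γ ⊩ φ → Γ ⊩ ∼ ∼ φ
⊩-∼∼ {φ = φ} d =
  by-cases (∼ φ) (explosion (hyp (here refl)) (weaken d)) (hyp (here refl))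

⊩-∼∨ : Γ ⊩ ∼ φ → Γ ⊩ ∼ ψ → Γ ⊩ ∼ (φ ∨ ψ)
⊩-∼∨ {φ = φ} {ψ = ψ} d e = by-cases (φ ∨ ψ)
  (⊩-∨-elim (hyp (here refl))
    (explosion (weaken (weaken d)) (hyp (here refl)))
    (explosion (weaken (weaken e)) (hyp (here refl))))
  (hyp (here refl))

-- Propositional completeness

Valuation : Set
Valuation = NameVar × NameVar → Bool

eval : Valuation → Formula → Bool
eval v (ε a b) = v (a , b)
eval v (φ ∨ ψ) = eval v φ ∨ᵇ eval v ψ
eval v (∼ φ)   = not (eval v φ)

signed : Bool → Formula → Formula
signed s φ = if s then φ else ∼ φ

-- Bounds the names in the formula, which fixes both the finitely many atoms to branch on and the
-- index of the star frame.
rank : Formula → ℕ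
rank (ε a b) = a ⊔ b
rank (φ ∨ ψ) = rank φ ⊔ rank ψ
rank (∼ φ)   = rank φ

Decides : List Formula → Valuation → NameVar × NameVar → Set
Decides Γ v (a , b) = Γ ⊩ signed (v (a , b)) (ε a b)

-- The bound `n` is kept apart from `rank φ` so that one family of decided atoms serves every
-- subformula.
kalmár : ∀ {n v} → (∀ {a b} → a ≤ n → b ≤ n → Decides Γ v (a , b)) →
         ∀ φ → rank φ ≤ n → Γ ⊩ signed (eval v φ) φ
kalmár ds (ε a b) r = ds (m⊔n≤o⇒m≤o a b r) (m⊔n≤o⇒n≤o a b r)
kalmár {v = v} ds (φ ∨ ψ) r
  with eval v φ | kalmár ds φ (m⊔n≤o⇒m≤o (rank φ) (rank ψ) r)
     | eval v ψ | kalmár ds ψ (m⊔n≤o⇒n≤o (rank φ) (rank ψ) r)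
... | true  | d | _     | _ = app (axiom (∨-inˡ _ _)) d
... | false | _ | true  | e = app (axiom (∨-inʳ _ _)) e
... | false | d | false | e = ⊩-∼∨ d e
kalmár {v = v} ds (∼ φ) r with eval v φ | kalmár ds φ r
... | true  | d = ⊩-∼∼ d
... | false | d = d

_≟ₐ_ : (x y : NameVar × NameVar) → Dec (x ≡ y)
_≟ₐ_ = ≡-dec _≟_ _≟_

_[_↦_] : Valuation → NameVar × NameVar → Bool → Valuation
(v [ x ↦ s ]) y = if does (x ≟ₐ y) then s else v y

-- Invariant of the branching: each atom is pending in the list or decided. An atom equal to
-- `(a , b)` becomes decided by the new hypothesis, whatever its earlier status; any other keeps its
-- place.
decides-update : ∀ {v} a b s {y L} → y ∈ (a , b) ∷ L ⊎ Decides Γ v y →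
                 y ∈ L ⊎ Decides (signed s (ε a b) ∷ Γ) (v [ (a , b) ↦ s ]) y
decides-update a b s {y} i with (a , b) ≟ₐ y
decides-update a b s i                   | yes refl = inj₂ (hyp (here refl))
decides-update a b s (inj₁ (here refl))  | no x≢y   = contradiction refl x≢y
decides-update a b s (inj₁ (there i))    | no _     = inj₁ i
decides-update a b s (inj₂ d)            | no _     = inj₂ (weaken d)

names : ℕ → List NameVar
names n = upTo (suc n)

∈-names : ∀ {a n} → a ≤ n → a ∈ names n
∈-names = ∈-upTo⁺ ∘ s≤s

signed-T : ∀ {s} → T s → Γ ⊩ signed s φ → Γ ⊩ φ
signed-T {s = true} _ d = d

tautology⇒⊢ : ∀ φ → (∀ v → T (eval v φ)) → ⊢ φ
-- The starting valuation is arbitrary: every atom up to `n` is pending and gets its value on the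
-- way to a leaf.
tautology⇒⊢ φ valid = ⊩-closed (branch (cartesianProduct (names n) (names n)) (λ _ → false)
  λ a≤n b≤n → inj₁ (∈-cartesianProduct⁺ (∈-names a≤n) (∈-names b≤n)))
  where
  n = rank φ

  -- Excluded middle splits on each pending atom. At a leaf all atoms up to `n` are decided, so
  -- `kalmár` derives φ from the chosen literals, and the cases recombine.
  branch : ∀ L v → (∀ {a b} → a ≤ n → b ≤ n → (a , b) ∈ L ⊎ Decides Γ v (a , b)) → Γ ⊩ φ
  branch {Γ} [] v ds = signed-T (valid v) (kalmár decided φ ≤-refl)
    where
    decided : ∀ {a b} → a ≤ n → b ≤ n → Decides Γ v (a , b)
    decided a≤n b≤n with ds a≤n b≤n
    ... | inj₂ d = d
  branch ((a , b) ∷ L) v ds = by-cases (ε a b)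
    (branch L (v [ (a , b) ↦ true ])  λ p q → decides-update {v = v} a b true  (ds p q))
    (branch L (v [ (a , b) ↦ false ]) λ p q → decides-update {v = v} a b false (ds p q))

T-⊃⁺ : ∀ s {t} → (T s → T t) → T (not s ∨ᵇ t)
T-⊃⁺ true  h = h tt
T-⊃⁺ false h = tt

T-⊃⁻ : ∀ s {t} → T (not s ∨ᵇ t) → T s → T t
T-⊃⁻ true h _ = h

T-∧⁺ : ∀ s t → T s → T t → T (not (not s ∨ᵇ not t))
T-∧⁺ true true _ _ = tt

-- A premise moves into the goal as an antecedent and, being a theorem, is detached again by modus
-- ponens.
entails⇒⊢ : ∀ (Θ : List (∃[ ψ ] ⊢ ψ)) φ →
            (∀ v → All (T ∘ eval v ∘ proj₁) Θ → T (eval v φ)) → ⊢ φ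
entails⇒⊢ []            φ h = tautology⇒⊢ φ λ v → h v []
entails⇒⊢ ((ψ , d) ∷ Θ) φ h =
  mp (entails⇒⊢ Θ (ψ ⊃ φ) λ v hs → T-⊃⁺ (eval v ψ) λ t → h v (t ∷ hs)) d

-- Completeness of L₁

-- Restricted to names up to `n`, so that finitely many axiom instances express it.
record IsModel (n : ℕ) (v : Valuation) : Set where
  field
    ε-reflˡ : ∀ {a b} → a ≤ n → b ≤ n → T (v (a , b)) → T (v (a , a))
    ε-trans : ∀ {a b c} → a ≤ n → b ≤ n → c ≤ n →
              T (v (a , b)) → T (v (b , c)) → T (v (a , c))
    ε-sym   : ∀ {a b c} → a ≤ n → b ≤ n → c ≤ n →
              T (v (a , b)) → T (v (b , c)) → T (v (b , a))

axiomsAt : NameVar × NameVar × NameVar → List (∃[ ψ ] ⊢ ψ)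
axiomsAt (a , b , c) = (_ , ax1 a b) ∷ (_ , ax2 a b c) ∷ (_ , ax3 a b c) ∷ []

triples : ℕ → List (NameVar × NameVar × NameVar)
triples n = cartesianProduct (names n) (cartesianProduct (names n) (names n))

axiomsUpTo : ℕ → List (∃[ ψ ] ⊢ ψ)
axiomsUpTo n = concatMap axiomsAt (triples n)

axioms⇒model : ∀ n v → All (T ∘ eval v ∘ proj₁) (axiomsUpTo n) → IsModel n v
axioms⇒model n v hs = record
  -- `ax1` mentions two names only; `b` fills the third place of the triple.
  { ε-reflˡ = λ {a} {b} a≤n b≤n → T-⊃⁻ (v (a , b)) (All.head (at a≤n b≤n b≤n))
  ; ε-trans = λ {a} {b} {c} a≤n b≤n c≤n ab bc →
      T-⊃⁻ (eval v (ε a b ∧ ε b c)) (All.head (All.tail (at a≤n b≤n c≤n)))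
        (T-∧⁺ (v (a , b)) (v (b , c)) ab bc)
  ; ε-sym   = λ {a} {b} {c} a≤n b≤n c≤n ab bc →
      T-⊃⁻ (eval v (ε a b ∧ ε b c)) (All.head (All.tail (All.tail (at a≤n b≤n c≤n))))
        (T-∧⁺ (v (a , b)) (v (b , c)) ab bc)
  }
  where
  at : ∀ {a b c} → a ≤ n → b ≤ n → c ≤ n → All (T ∘ eval v ∘ proj₁) (axiomsAt (a , b , c))
  at a≤n b≤n c≤n = All.lookup (map⁻ (concat⁻ {xss = map axiomsAt (triples n)} hs))
    (∈-cartesianProduct⁺ (∈-names a≤n) (∈-cartesianProduct⁺ (∈-names b≤n) (∈-names c≤n)))

L₁-complete : ∀ n φ → (∀ v → IsModel n v → T (eval v φ)) → ⊢ φ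
L₁-complete n φ h = entails⇒⊢ (axiomsUpTo n) φ λ v → h v ∘ axioms⇒model n v

-- Kripke semantics

module Forcing {ℓ} (𝓕 : Frame ℓ) (V : PropVar → Pred (Frame.World 𝓕) ℓ) where

  -- Every clause except that of □ is a negation, hence stable, and □ quantifies universally over
  -- stable statements.
  Forces-stable : ∀ {w} φ → ¬ ¬ Forces 𝓕 V w φ → Forces 𝓕 V w φ
  Forces-stable (Modal.var p) h k     = h λ f → f k
  Forces-stable (φ Modal.∨ ψ) h k     = h λ f → f k
  Forces-stable (Modal.∼ φ)   h k     = h λ f → f k
  Forces-stable (Modal.□ φ)   h u wRu = Forces-stable φ λ k → h λ f → k (f u wRu)

  Forces-⊃⁺ : ∀ {w} φ ψ → (Forces 𝓕 V w φ → Forces 𝓕 V w ψ) → Forces 𝓕 V w (φ Modal.⊃ ψ)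
  Forces-⊃⁺ _ _ h k = k (inj₁ λ f → k (inj₂ (h f)))

  Forces-⊃⁻ : ∀ {w} φ ψ → Forces 𝓕 V w (φ Modal.⊃ ψ) → Forces 𝓕 V w φ → Forces 𝓕 V w ψ
  Forces-⊃⁻ _ ψ h f = Forces-stable ψ λ k → h λ where
    (inj₁ ¬f) → ¬f f
    (inj₂ g)  → k g

  Forces-∧⁺ : ∀ {w} φ ψ → Forces 𝓕 V w φ → Forces 𝓕 V w ψ → Forces 𝓕 V w (φ Modal.∧ ψ)
  Forces-∧⁺ _ _ f g h = h λ where
    (inj₁ ¬f) → ¬f f
    (inj₂ ¬g) → ¬g g

  Forces-∧⁻ˡ : ∀ {w} φ ψ → Forces 𝓕 V w (φ Modal.∧ ψ) → Forces 𝓕 V w φ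
  Forces-∧⁻ˡ φ _ h = Forces-stable φ λ k → h λ l → l (inj₁ k)

  Forces-∧⁻ʳ : ∀ {w} φ ψ → Forces 𝓕 V w (φ Modal.∧ ψ) → Forces 𝓕 V w ψ
  Forces-∧⁻ʳ _ ψ h = Forces-stable ψ λ k → h λ l → l (inj₂ k)

-- Models of L₁ as valuations on star frames

module StarModel {ℓ} (p : NameVar ↣ PropVar) {n} {𝓕 : Frame ℓ} (star : IsStarFrame n 𝓕)
                 {v} (model : IsModel n v) where
  open Frame 𝓕
  open IsStarFrame star
  open IsModel model
  open Injection p using (to; injective)

  -- The name is quantified because `to` need not be surjective; variables outside its image are
  -- false everywhere. All variables are false at the worlds `η k`, which ⋆ never reaches.
  V : PropVar → Pred World ℓ
  V q w = ∃[ a ] to a ≡ q ×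
    ((w ≡ ⋆ × T (v (a , a))) ⊎ (∃[ j ] w ≡ g j × T (v (toℕ j , a))))

  _⊨_ : World → Modal.Formula → Set ℓ
  w ⊨ φ = Forces 𝓕 V w φ

  -- Distinctness of the worlds excludes the other edges. The source is a variable with an equation
  -- because ⋆, `g` and `η` are not constructors that matching could unify.
  ⋆-successor : ∀ {w u} → w ≡ ⋆ → StarRel n ⋆ g η w u → ∃[ j ] u ≡ g j
  ⋆-successor eq (⋆→g j)         = j , refl
  ⋆-successor eq (g→⋆ j)         = ⊥-elim (⋆≢g j (sym eq))
  ⋆-successor eq (g→g j _ _ _ _) = ⊥-elim (⋆≢g j (sym eq))
  ⋆-successor eq (η→η k)         = ⊥-elim (⋆≢η k (sym eq))

  ⋆□⁺ : ∀ φ → (∀ j → g j ⊨ φ) → ⋆ ⊨ (Modal.□ φ)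
  ⋆□⁺ φ h u ⋆Ru with ⋆-successor refl (Equivalence.to (R⇔StarRel ⋆ u) ⋆Ru)
  ... | j , refl = h j

  ⋆□⁻ : ∀ φ → ⋆ ⊨ (Modal.□ φ) → ∀ j → g j ⊨ φ
  ⋆□⁻ φ h j = h (g j) (Equivalence.from (R⇔StarRel ⋆ (g j)) (⋆→g j))

  ⋆-var⁺ : ∀ {a} → T (v (a , a)) → ⋆ ⊨ Modal.var (to a)
  ⋆-var⁺ t k = k (_ , refl , inj₁ (refl , t))

  ⋆-var⁻ : ∀ {a} → ⋆ ⊨ Modal.var (to a) → T (v (a , a))
  ⋆-var⁻ {a} h = decidable-stable (T? _) λ k → h λ where
    (b , eq , inj₁ (_ , t))      → k (subst (λ c → T (v (c , c))) (injective eq) t)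
    (b , eq , inj₂ (j , ⋆≡g , _)) → ⋆≢g j ⋆≡g

  g-var⁺ : ∀ {a} j → T (v (toℕ j , a)) → g j ⊨ Modal.var (to a)
  g-var⁺ j t k = k (_ , refl , inj₂ (j , refl , t))

  g-var⁻ : ∀ {a} j → g j ⊨ Modal.var (to a) → T (v (toℕ j , a))
  g-var⁻ {a} j h = decidable-stable (T? _) λ k → h λ where
    (b , eq , inj₁ (g≡⋆ , _))     → ⋆≢g j (sym g≡⋆)
    (b , eq , inj₂ (i , gj≡gi , t)) → k (subst (λ c → T (v (toℕ j , c))) (injective eq)
      (subst (λ i → T (v (toℕ i , b))) (sym (g-injective gj≡gi)) t))

  open Forcing 𝓕 V

  module _ {a b} (a≤n : a ≤ n) (b≤n : b ≤ n) where

    private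
      pᵃ pᵇ pᵃ⊆pᵇ pᵇ⊆pᵃ : Modal.Formula
      pᵃ    = Modal.var (to a)
      pᵇ    = Modal.var (to b)
      pᵃ⊆pᵇ = Modal.□ (pᵃ Modal.⊃ pᵇ)
      pᵇ⊆pᵃ = Modal.□ (pᵇ Modal.⊃ pᵃ)

    ε⇒Bε : T (v (a , b)) → ⋆ ⊨ B p (ε a b)
    ε⇒Bε ab =
      Forces-∧⁺ pᵃ (pᵃ⊆pᵇ Modal.∧ (pᵇ Modal.⊃ pᵇ⊆pᵃ)) (⋆-var⁺ (ε-reflˡ a≤n b≤n ab))
        (Forces-∧⁺ pᵃ⊆pᵇ (pᵇ Modal.⊃ pᵇ⊆pᵃ) forwards
          -- `pᵇ` at ⋆ means v b b, so (Ax3) with c = b turns v a b into v b a, as `backwards`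
          -- requires.
          (Forces-⊃⁺ pᵇ pᵇ⊆pᵃ (backwards ∘ ε-sym a≤n b≤n b≤n ab ∘ ⋆-var⁻)))
      where
      forwards : ⋆ ⊨ pᵃ⊆pᵇ
      -- The indices of the worlds `g j` are names up to `n`, so (Ax2) applies to j, a, b.
      forwards = ⋆□⁺ (pᵃ Modal.⊃ pᵇ) λ j → Forces-⊃⁺ pᵃ pᵇ λ ja →
        g-var⁺ j (ε-trans (toℕ≤pred[n] j) a≤n b≤n (g-var⁻ j ja) ab)

      backwards : T (v (b , a)) → ⋆ ⊨ pᵇ⊆pᵃ
      backwards ba = ⋆□⁺ (pᵇ Modal.⊃ pᵃ) λ j → Forces-⊃⁺ pᵇ pᵃ λ jb →
        g-var⁺ j (ε-trans (toℕ≤pred[n] j) b≤n a≤n (g-var⁻ j jb) ba)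

    Bε⇒ε : ⋆ ⊨ B p (ε a b) → T (v (a , b))
    Bε⇒ε h = subst (λ c → T (v (c , b))) toℕ-j≡a
      (g-var⁻ j (Forces-⊃⁻ pᵃ pᵇ (⋆□⁻ (pᵃ Modal.⊃ pᵇ) inclusion j)
        (g-var⁺ j (subst (λ c → T (v (c , a))) (sym toℕ-j≡a) aa))))
      where
      j : Fin (suc n)
      -- The indices run from 0 to `n`, so a ≤ n places the test world g_a among the successors of
      -- ⋆.
      j = fromℕ< (s≤s a≤n)

      toℕ-j≡a : toℕ j ≡ a
      toℕ-j≡a = toℕ-fromℕ< (s≤s a≤n)

      rest = pᵃ⊆pᵇ Modal.∧ (pᵇ Modal.⊃ pᵇ⊆pᵃ)

      aa : T (v (a , a))
      aa = ⋆-var⁻ (Forces-∧⁻ˡ pᵃ rest h)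

      inclusion : ⋆ ⊨ pᵃ⊆pᵇ
      inclusion = Forces-∧⁻ˡ pᵃ⊆pᵇ (pᵇ Modal.⊃ pᵇ⊆pᵃ) (Forces-∧⁻ʳ pᵃ rest h)

  -- Mutual induction, since negation exchanges the two directions.
  truth⁺ : ∀ φ → rank φ ≤ n → T (eval v φ) → ⋆ ⊨ B p φ
  truth⁻ : ∀ φ → rank φ ≤ n → ⋆ ⊨ B p φ → T (eval v φ)

  truth⁺ (ε a b) r t = ε⇒Bε (m⊔n≤o⇒m≤o a b r) (m⊔n≤o⇒n≤o a b r) t
  truth⁺ (φ ∨ ψ) r t k with eval v φ | truth⁺ φ (m⊔n≤o⇒m≤o (rank φ) (rank ψ) r)
  ... | true  | h = k (inj₁ (h tt))
  ... | false | _ = k (inj₂ (truth⁺ ψ (m⊔n≤o⇒n≤o (rank φ) (rank ψ) r) t))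
  truth⁺ (∼ φ)   r t f with eval v φ | truth⁻ φ r f
  ... | true  | _ = t
  ... | false | h = h

  truth⁻ (ε a b) r h = Bε⇒ε (m⊔n≤o⇒m≤o a b r) (m⊔n≤o⇒n≤o a b r) h
  truth⁻ (φ ∨ ψ) r h = decidable-stable (T? _) λ k → h λ where
    (inj₁ f) → k (Equivalence.from T-∨ (inj₁ (truth⁻ φ (m⊔n≤o⇒m≤o (rank φ) (rank ψ) r) f)))
    (inj₂ g) → k (Equivalence.from (T-∨ {eval v φ}) (inj₂ (truth⁻ ψ (m⊔n≤o⇒n≤o (rank φ) (rank ψ) r) g)))
  truth⁻ (∼ φ)   r h with eval v φ | truth⁺ φ r
  ... | true  | f = h (f tt)
  ... | false | _ = tt

theorem7p7 : ∀ {x i ℓ : Level}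
    (p : NameVar ↣ PropVar)
    (X : Pred Modal.Formula x) → Modal.IsNormal X →
    (I : Set i) (ω⊆I : ℕ ↣ I)
    (F : I → Frame ℓ) →
    (∀ α → Frame.World (F α)) →
    (∀ α → Infinite (Frame.World (F α))) →
    CompleteWrt X F →
    (H : ℕ → Frame ℓ) → (∀ n → IsStarFrame n (H n)) →
    (∀ n → ∃[ α ] F α ≡ H n) →
    Faithful p X
theorem7p7 p X _ I _ F _ _ complete H star H⊆F φ X[Bφ] = L₁-complete n φ λ v model →
  let open StarModel p (star n) model
  in truth⁻ φ ≤-refl (valid V (IsStarFrame.⋆ (star n)))
  where
  -- Makes every name a of φ index a world g_a of the frame.
  n = rank φ

  valid : Valid (H n) (B p φ)
  valid with α , Fα≡H ← H⊆F n =
    subst (λ 𝓕 → Valid 𝓕 (B p φ)) Fα≡H (Equivalence.to (complete (B p φ)) X[Bφ] α)
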